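{- Let $R$ be a finite ring and let $p_1,\dots,p_n$ be the distinct primes dividing $|R|$. Then for every integer $k\ge 1$, $$|\mathcal{I}_{k+1}(R)|\le \frac{(k+1)^n}{\prod_{i=1}^n p_i}\,|R|^{\frac{2k}{k+1}},$$ where $\mathcal{I}_{k+1}(R)=\{x\in R: x^{k+1}=x\}$ is the set of $(k+1)$-potent elements of $R$. -}

module Defs where

open import Level using (Level; _⊔_)
open import Algebra.Bundles using (Ring)
open import Data.Nat using (ℕ; zero; suc; _≤_)
open import Data.Nat.Divisibility using (_∣?_)
open import Data.Nat.Primality using (prime?)
open import Data.Fin using (Fin)
open import Data.List using (List; filter; length; upTo; allFin)
open import Data.Product using (∃; _×_)
open import Relation.Nullary.Decidable using (_×-dec_)
open import Relation.Binary.Definitions using (Decidable)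
open import Relation.Binary.PropositionalEquality using (_≡_)

-- A finite ring: a (unital) ring R together with an explicit enumeration
-- of its elements by Fin size (injective and surjective up to the ring's ≈),
-- and decidability of ≈ (automatic classically for a finite set).
record FiniteRing (c ℓ : Level) : Set (Level.suc (c ⊔ ℓ)) where
  field
    ring : Ring c ℓ
  open Ring ring public
  field
    size      : ℕ
    enum      : Fin size → Carrier
    enum-inj  : ∀ i j → enum i ≈ enum j → i ≡ j
    enum-surj : ∀ x → ∃ λ i → enum i ≈ x
    _≟R_      : Decidable _≈_

  _^R_ : Carrier → ℕ → Carrier
  x ^R zero  = 1#
  x ^R suc m = x * (x ^R m)

  potentCount : ℕ → ℕ
  potentCount m = length (filter (λ i → (enum i ^R m) ≟R enum i) (allFin size))

primeDivisors : ℕ → List ℕ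
primeDivisors N = filter (λ p → prime? p ×-dec p ∣? N) (upTo (suc N))

{-# OPTIONS --safe #-}
module Submission where

-- Write |R| = pᵃ m with p ∤ m and let u = m·1. On a line {x + t u : 0 ≤ t < p} the elements y with
-- m (yᵏ⁺¹ - y) = 0 are roots t of a polynomial of degree k+1; differences of distinct t < p are prime to p and hence
-- cancellable on mR, so there are at most k+1 of them, provided that the leading coefficient uᵏ⁺¹ is not killed by m.
-- For two primes p ≠ q the product m_p m_q kills R, so the condition at q is constant on the lines for p.
-- Averaging over these lines, one prime after another, gives |I_{k+1}(R)| ∏ pᵢ ≤ (k+1)ⁿ |R|, and |R| ≤ |R|^(2k/(k+1)).
-- The leading coefficient survives because a number n with n R = 0 is divisible by every prime dividing |R|: the map
-- (ℤ/n)^R → R, (jᵧ) ↦ Σ jᵧ y, is surjective with fibres of equal size, so |R| divides a power of n.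

open import Defs
open import Level using (Level; _⊔_)
open import Algebra.Bundles using (Ring)
open import Data.Bool using (true; false; if_then_else_)
open import Data.Nat as ℕ using (ℕ; zero; suc; _≤_; _<_; _*_; _^_; z≤n; s≤s; NonZero; nonTrivial⇒n>1)
open import Data.Nat.ListAction using (product)
open import Data.Nat.Properties as ℕₚ using (+-*-semiring; module ≤-Reasoning)
open import Data.Nat.Divisibility
open import Data.Nat.Coprimality as Coprimality using (Coprime; coprime-divisor; coprime-Bézout; prime⇒coprime)
open import Data.Nat.GCD using (module Bézout)
open import Data.Nat.Induction using (<-rec)
open import Data.Nat.Primality using (Prime; prime⇒nonTrivial; prime⇒irreducible; euclidsLemma; prime?)
open import Data.Fin as Fin using (Fin; zero; suc; toℕ)
open import Data.Fin.Properties using (toℕ<n)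
open import Data.Fin.Permutation using (Permutation′; permutation; _⟨$⟩ʳ_)
open import Data.List using (List; []; _∷_; length; filter; tabulate; upTo)
open import Data.List.Membership.Propositional using (_∈_)
open import Data.List.Membership.Propositional.Properties using (∈-tabulate⁺)
open import Data.List.Relation.Unary.All as All using (All; []; _∷_)
open import Data.List.Relation.Unary.All.Properties using (all-filter)
open import Data.List.Relation.Unary.AllPairs using ([]; _∷_)
open import Data.List.Relation.Unary.Any using (here; there)
open import Data.List.Relation.Unary.Unique.Propositional using (Unique)
open import Data.List.Relation.Unary.Unique.Propositional.Properties using (filter⁺; upTo⁺)
open import Data.Product using (_,_; proj₁; proj₂)
open import Data.Sum using (inj₁; inj₂; [_,_]′)
open import Function using (_∘_; id)
open import Relation.Nullary using (¬_; Dec; yes; no; does; contradiction)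
open import Relation.Nullary.Decidable using (_×-dec_; dec-true)
open import Relation.Unary using (Pred; Decidable)
open import Relation.Binary.PropositionalEquality as ≡ using (_≡_; _≢_; cong; cong₂; subst)
open import Algebra.Properties.Semiring.Sum +-*-semiring using (∑-comm; ∑-permute; sum; sum-cong-≗; sum-syntax; *-distribˡ-sum; *-distribʳ-sum)
import Algebra.Properties.CommutativeMonoid.Sum
import Algebra.Properties.CommutativeMonoid.Mult
import Algebra.Properties.Semiring.Mult
import Algebra.Properties.CommutativeSemigroup
import Algebra.Properties.Group
import Relation.Binary.Reasoning.Setoid

private
  variable
    a c ℓ : Level

-- Indicators and finite sums of natural numbers

indicator : {A : Set a} → Dec A → ℕ
indicator A? = if does A? then 1 else 0

indicator-true : {A : Set a} (A? : Dec A) → A → indicator A? ≡ 1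
indicator-true A? x = cong (if_then 1 else 0) (dec-true A? x)

indicator-mono : ∀ {b} {A : Set a} {B : Set b} (A? : Dec A) (B? : Dec B) →
  (A → B) → indicator A? ≤ indicator B?
indicator-mono (no _)  B? f = z≤n
indicator-mono (yes x) B? f = ℕₚ.≤-reflexive (≡.sym (indicator-true B? (f x)))

indicator-cong : ∀ {b} {A : Set a} {B : Set b} (A? : Dec A) (B? : Dec B) →
  (A → B) → (B → A) → indicator A? ≡ indicator B?
indicator-cong A? B? f g = ℕₚ.≤-antisym (indicator-mono A? B? f) (indicator-mono B? A? g)

sum-mono : ∀ {n} {f g : Fin n → ℕ} → (∀ i → f i ≤ g i) → sum f ≤ sum g
sum-mono {zero}  f≤g = z≤n
sum-mono {suc n} f≤g = ℕₚ.+-mono-≤ (f≤g zero) (sum-mono (f≤g ∘ suc))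

sum-const : ∀ n c → sum {n} (λ _ → c) ≡ n * c
sum-const zero    c = ≡.refl
sum-const (suc n) c = cong (c ℕ.+_) (sum-const n c)

-- The left sum gains `F N` and loses `F 0`. It is applied to coefficients modulo n, where n × g ≈ 0
-- closes the cycle.
sum-cycle : ∀ (F : ℕ → ℕ) N → F N ≡ F 0 → sum {N} (F ∘ suc ∘ toℕ) ≡ sum {N} (F ∘ toℕ)
sum-cycle F N FN≡F0 = ℕₚ.+-cancelˡ-≡ (F 0) _ _ (≡.trans (snoc F N)
  (≡.trans (ℕₚ.+-comm _ (F N)) (cong (ℕ._+ sum {N} (F ∘ toℕ)) FN≡F0)))
  where
  snoc : ∀ (F : ℕ → ℕ) N → sum {suc N} (F ∘ toℕ) ≡ sum {N} (F ∘ toℕ) ℕ.+ F N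
  snoc F zero    = ℕₚ.+-identityʳ (F 0)
  snoc F (suc N) = ≡.trans (cong (F 0 ℕ.+_) (snoc (F ∘ suc) N)) (≡.sym (ℕₚ.+-assoc (F 0) _ _))

length-filter-tabulate : ∀ {b} {A : Set a} {P : Pred A b} (P? : Decidable P) {n} (f : Fin n → A) →
  length (filter P? (tabulate f)) ≡ sum (λ i → indicator (P? (f i)))
length-filter-tabulate P? {zero}  f = ≡.refl
length-filter-tabulate P? {suc n} f with does (P? (f zero))
... | true  = cong suc (length-filter-tabulate P? (f ∘ suc))
... | false = length-filter-tabulate P? (f ∘ suc)

-- Coprime parts of a number

-- A divisor of m is itself coprime to n, so the factors n can be stripped from the power one at a
-- time.
coprime-^ : ∀ {m n} e → Coprime m n → Coprime m (n ^ e)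
coprime-^ zero    m⊥n (_ , d∣1) = ∣1⇒≡1 d∣1
coprime-^ (suc e) m⊥n (d∣m , d∣n*nᵉ) =
  coprime-^ e m⊥n (d∣m , coprime-divisor (λ (i∣d , i∣n) → m⊥n (∣-trans i∣d d∣m , i∣n)) d∣n*nᵉ)

prime≢1 : ∀ {p} → Prime p → p ≢ 1
prime≢1 pp ≡.refl = contradiction (nonTrivial⇒n>1 1 {{prime⇒nonTrivial pp}}) (ℕₚ.<-irrefl ≡.refl)

distinct-primes-coprime : ∀ {p q} → Prime p → Prime q → p ≢ q → Coprime p q
distinct-primes-coprime pp qq p≢q (d∣p , d∣q) with prime⇒irreducible pp d∣p
... | inj₁ d≡1 = d≡1
... | inj₂ ≡.refl with prime⇒irreducible qq d∣q
...   | inj₁ p≡1 = p≡1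
...   | inj₂ p≡q = contradiction p≡q p≢q

prime∣^⇒∣ : ∀ {p} m e → Prime p → p ∣ m ^ e → p ∣ m
prime∣^⇒∣ m zero    pp p∣1 = contradiction (∣1⇒≡1 p∣1) (prime≢1 pp)
prime∣^⇒∣ m (suc e) pp p∣m*mᵉ = [ id , prime∣^⇒∣ m e pp ]′ (euclidsLemma m (m ^ e) pp p∣m*mᵉ)

-- For N = |R|, multiplication by `cofactor` is injective on the p-primary component of R and kills
-- all the others, so it isolates R at p.
record PrimePart (N p : ℕ) : Set where
  field
    isPrime    : Prime p
    exponent   : ℕ
    cofactor   : ℕ
    factors    : N ≡ p ^ exponent * cofactor
    p∤cofactor : p ∤ cofactor

primePart : ∀ {p} → Prime p → ∀ N → .{{NonZero N}} → PrimePart N p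
primePart {p} pp N = <-rec (λ N → .{{NonZero N}} → PrimePart N p) step N
  where
  step : ∀ N → (∀ {M} → M < N → .{{NonZero M}} → PrimePart M p) → .{{NonZero N}} → PrimePart N p
  step N rec with p ∣? N
  ... | no p∤N = record
    { isPrime = pp ; exponent = 0 ; cofactor = N ; factors = ≡.sym (ℕₚ.*-identityˡ N) ; p∤cofactor = p∤N }
  ... | yes p∣N = record
    { isPrime = pp ; exponent = suc exponent ; cofactor = cofactor
    ; factors = ≡.trans (_∣_.equality p∣N) (≡.trans (ℕₚ.*-comm q p)
                  (≡.trans (cong (p *_) factors) (≡.sym (ℕₚ.*-assoc p _ _))))
    ; p∤cofactor = p∤cofactor }
    where
    q = quotient p∣N
    open PrimePart (rec (quotient-< p∣N {{prime⇒nonTrivial pp}}) {{quotient≢0 p∣N}})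

-- The p-part of N is prime to the q-part, so it divides the cofactor at q; what N has besides its
-- p-part is the cofactor at p.
N∣cofactors : ∀ {N p q} (P : PrimePart N p) (Q : PrimePart N q) → p ≢ q →
  N ∣ PrimePart.cofactor Q * PrimePart.cofactor P
N∣cofactors {N} {p} {q} P Q p≢q = subst (_∣ Q.cofactor * P.cofactor) (≡.sym P.factors)
  (*-monoˡ-∣ P.cofactor (coprime-divisor pᵃ⊥qᵇ
    (subst (p ^ P.exponent ∣_) (≡.trans (≡.sym P.factors) Q.factors) (m∣m*n P.cofactor))))
  where
  module P = PrimePart P
  module Q = PrimePart Q
  pᵃ⊥qᵇ : Coprime (p ^ P.exponent) (q ^ Q.exponent)
  pᵃ⊥qᵇ = coprime-^ Q.exponent (Coprimality.sym (coprime-^ P.exponent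
            (Coprimality.sym (distinct-primes-coprime P.isPrime Q.isPrime p≢q))))

-- Polynomial functions ℕ → R in a central integer variable

module IntegerPolynomials (R : Ring c ℓ) where
  open Ring R hiding (zero) renaming (_*_ to _·_)
  open Algebra.Properties.Semiring.Mult semiring public
  open Algebra.Properties.CommutativeMonoid.Mult +-commutativeMonoid public using (×-distrib-+)
  open Algebra.Properties.CommutativeSemigroup +-commutativeSemigroup using (interchange)
  open Relation.Binary.Reasoning.Setoid setoid

  ×-zeroʳ : ∀ n → n × 0# ≈ 0#
  ×-zeroʳ zero    = refl
  ×-zeroʳ (suc n) = trans (+-identityˡ _) (×-zeroʳ n)

  ×-swap : ∀ m n x → m × (n × x) ≈ n × (m × x)
  ×-swap m n x = begin
    m × (n × x)  ≈⟨ ×-assocˡ x m n ⟩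
    (m * n) × x  ≈⟨ ×-congˡ (ℕₚ.*-comm m n) ⟩
    (n * m) × x  ≈⟨ ×-assocˡ x n m ⟨
    n × (m × x)  ∎

  ×-zero-∣ : ∀ {m n x} → m ∣ n → m × x ≈ 0# → n × x ≈ 0#
  ×-zero-∣ {m} {n} {x} (divides q n≡q*m) mx≈0 = begin
    n × x        ≈⟨ ×-congˡ n≡q*m ⟩
    (q * m) × x  ≈⟨ ×-assocˡ x q m ⟨
    q × (m × x)  ≈⟨ ×-congʳ q mx≈0 ⟩
    q × 0#       ≈⟨ ×-zeroʳ q ⟩
    0#           ∎

  -- Both subtraction-free forms of Bézout's identity say that x plus a vanishing multiple of x is
  -- another vanishing multiple.
  ×-zero-coprime : ∀ {m n x} → Coprime m n → m × x ≈ 0# → n × x ≈ 0# → x ≈ 0#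
  ×-zero-coprime {m} {n} {x} m⊥n mx≈0 nx≈0 with coprime-Bézout m⊥n
  ... | Bézout.Identity.+- i j 1+jn≡im = begin
    x                  ≈⟨ +-identityʳ x ⟨
    x + 0#             ≈⟨ +-congˡ (×-zero-∣ (n∣m*n j) nx≈0) ⟨
    (1 ℕ.+ j * n) × x  ≈⟨ ×-congˡ 1+jn≡im ⟩
    (i * m) × x        ≈⟨ ×-zero-∣ (n∣m*n i) mx≈0 ⟩
    0#                 ∎
  ... | Bézout.Identity.-+ i j 1+im≡jn = begin
    x                  ≈⟨ +-identityʳ x ⟨
    x + 0#             ≈⟨ +-congˡ (×-zero-∣ (n∣m*n i) mx≈0) ⟨
    (1 ℕ.+ i * m) × x  ≈⟨ ×-congˡ 1+im≡jn ⟩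
    (j * n) × x        ≈⟨ ×-zero-∣ (n∣m*n j) nx≈0 ⟩
    0#                 ∎

  -- IsPoly n a f: f is a polynomial function of formal degree n, and a is its coefficient of tⁿ (possibly zero).
  data IsPoly : ℕ → Carrier → (ℕ → Carrier) → Set (c ⊔ ℓ) where
    constant : ∀ {a f} → (∀ t → f t ≈ a) → IsPoly 0 a f
    horner   : ∀ {n a f} b g → (∀ t → f t ≈ b + t × g t) → IsPoly n a g → IsPoly (suc n) a f

  IsPoly-resp : ∀ {n a b f g} → a ≈ b → (∀ t → f t ≈ g t) → IsPoly n a f → IsPoly n b g
  IsPoly-resp a≈b f≈g (constant f≈a)     = constant (λ t → trans (sym (f≈g t)) (trans (f≈a t) a≈b))
  IsPoly-resp a≈b f≈g (horner c h f≈ hp) =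
    horner c h (λ t → trans (sym (f≈g t)) (f≈ t)) (IsPoly-resp a≈b (λ _ → refl) hp)

  -- `IsPoly-+` requires equal formal degrees; padding supplies the missing ones.
  IsPoly-pad : ∀ {n a f} → IsPoly n a f → IsPoly (suc n) 0# f
  IsPoly-pad {a = a} (constant f≈a) = horner a (λ _ → 0#)
    (λ t → trans (f≈a t) (sym (trans (+-congˡ (×-zeroʳ t)) (+-identityʳ a)))) (constant (λ _ → refl))
  IsPoly-pad (horner b g f≈ gp) = horner b g f≈ (IsPoly-pad gp)

  IsPoly-const : ∀ n b → IsPoly (suc n) 0# (λ _ → b)
  IsPoly-const zero    b = IsPoly-pad (constant {a = b} (λ _ → refl))
  IsPoly-const (suc n) b = IsPoly-pad (IsPoly-const n b)

  IsPoly-t× : ∀ {n a f} → IsPoly n a f → IsPoly (suc n) a (λ t → t × f t)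
  IsPoly-t× fp = horner 0# _ (λ t → sym (+-identityˡ _)) fp

  IsPoly-+ : ∀ {n a b f g} → IsPoly n a f → IsPoly n b g → IsPoly n (a + b) (λ t → f t + g t)
  IsPoly-+ (constant f≈a) (constant g≈b) = constant (λ t → +-cong (f≈a t) (g≈b t))
  IsPoly-+ {f = f} {g} (horner b f′ f≈ f′p) (horner c g′ g≈ g′p) = horner (b + c) _ eq (IsPoly-+ f′p g′p)
    where
    eq : ∀ t → f t + g t ≈ (b + c) + t × (f′ t + g′ t)
    eq t = begin
      f t + g t                            ≈⟨ +-cong (f≈ t) (g≈ t) ⟩
      (b + t × f′ t) + (c + t × g′ t)      ≈⟨ interchange b _ c _ ⟩
      (b + c) + (t × f′ t + t × g′ t)      ≈⟨ +-congˡ (×-distrib-+ _ _ t) ⟨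
      (b + c) + t × (f′ t + g′ t)          ∎

  IsPoly-· : ∀ {n a f} x → IsPoly n a f → IsPoly n (x · a) (λ t → x · f t)
  IsPoly-· x (constant f≈a) = constant (λ t → *-congˡ (f≈a t))
  IsPoly-· {f = f} x (horner b g f≈ gp) = horner (x · b) _ eq (IsPoly-· x gp)
    where
    eq : ∀ t → x · f t ≈ x · b + t × (x · g t)
    eq t = begin
      x · f t                  ≈⟨ *-congˡ (f≈ t) ⟩
      x · (b + t × g t)        ≈⟨ distribˡ x b _ ⟩
      x · b + x · (t × g t)    ≈⟨ +-congˡ (×-comm-* t x _) ⟩
      x · b + t × (x · g t)    ∎

  -- f (t + 1) = b + g (t + 1) + t × g (t + 1), and only the last term reaches the top degree, so
  -- the leading coefficient survives.
  IsPoly-shift : ∀ {n a f} → IsPoly n a f → IsPoly n a (f ∘ suc)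
  IsPoly-shift (constant f≈a) = constant (f≈a ∘ suc)
  IsPoly-shift {suc n} {a} {f} (horner b g f≈ gp) =
    IsPoly-resp (trans (+-identityˡ _) (+-identityˡ a)) (λ t → sym (f≈ (suc t)))
      (IsPoly-+ (IsPoly-const n b) (IsPoly-+ (IsPoly-pad gp′) (IsPoly-t× gp′)))
    where
    gp′ = IsPoly-shift gp

  -- The integer t moves past `u`, so the top coefficient comes from t × (u · f t) alone; the term x
  -- · f t is padded.
  IsPoly-linear-· : ∀ {n a f} x u → IsPoly n a f → IsPoly (suc n) (u · a) (λ t → (x + t × u) · f t)
  IsPoly-linear-· {f = f} x u fp = IsPoly-resp (+-identityˡ _) eq
    (IsPoly-+ (IsPoly-pad (IsPoly-· x fp)) (IsPoly-t× (IsPoly-· u fp)))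
    where
    eq : ∀ t → x · f t + t × (u · f t) ≈ (x + t × u) · f t
    eq t = begin
      x · f t + t × (u · f t)  ≈⟨ +-congˡ (×-assoc-* t u (f t)) ⟨
      x · f t + (t × u) · f t  ≈⟨ distribʳ (f t) x _ ⟨
      (x + t × u) · f t        ∎

  -- Roots are removed in increasing order: a root at 0 is divided out, and otherwise the variable is shifted by one.
  roots≤degree : ∀ m p (zero? : ∀ y → Dec (m × y ≈ 0#)) →
    (∀ s y → 0 < s → s < p → m × (s × y) ≈ 0# → m × y ≈ 0#) →
    ∀ N → N ≤ p → ∀ {n a f} → IsPoly n a f → ¬ (m × a ≈ 0#) →
    sum {N} (λ t → indicator (zero? (f (toℕ t)))) ≤ n
  roots≤degree m p zero? cancel zero    N≤p fp ma≉0 = z≤n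
  roots≤degree m p zero? cancel (suc N) N<p {f = f} fp ma≉0 with zero? (f 0)
  ... | no  _    = roots≤degree m p zero? cancel N (ℕₚ.<⇒≤ N<p) (IsPoly-shift fp) ma≉0
  ... | yes mf₀≈0 with fp
  ...   | constant f≈a = contradiction (trans (×-congʳ m (sym (f≈a 0))) mf₀≈0) ma≉0
  -- Since m × b ≈ 0, a root s of f with 0 < s < p is a root of g by `cancel`, and g has formal
  -- degree one lower.
  ...   | horner b g f≈ gp = s≤s (ℕₚ.≤-trans
            (sum-mono {N} (λ t → indicator-mono (zero? (f (suc (toℕ t)))) (zero? (g (suc (toℕ t)))) (root-of-g t)))
            (roots≤degree m p zero? cancel N (ℕₚ.<⇒≤ N<p) (IsPoly-shift gp) ma≉0))
    where
    mb≈0 : m × b ≈ 0#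
    mb≈0 = trans (×-congʳ m (sym (trans (f≈ 0) (+-identityʳ b)))) mf₀≈0
    root-of-g : ∀ (t : Fin N) → m × f (suc (toℕ t)) ≈ 0# → m × g (suc (toℕ t)) ≈ 0#
    root-of-g t mf≈0 = cancel s (g s) (s≤s z≤n) (ℕₚ.≤-<-trans (toℕ<n t) N<p) (begin
        m × (s × g s)            ≈⟨ +-identityˡ _ ⟨
        0# + m × (s × g s)       ≈⟨ +-congʳ mb≈0 ⟨
        m × b + m × (s × g s)    ≈⟨ ×-distrib-+ b _ m ⟨
        m × (b + s × g s)        ≈⟨ ×-congʳ m (f≈ s) ⟨
        m × f s                  ≈⟨ mf≈0 ⟩
        0#                       ∎)
      where s = suc (toℕ t)

-- Sums over a finite ring and their translation invariance

module FiniteRingCounting (R : FiniteRing c ℓ) where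
  open FiniteRing R hiding (zero) renaming (_*_ to _·_)
  open IntegerPolynomials ring
  open Algebra.Properties.Group +-group using (∙-cancelˡ)
  open Relation.Binary.Reasoning.Setoid setoid using (begin_; _∎; step-≈-⟩; step-≈-⟨)
  private module ΣR = Algebra.Properties.CommutativeMonoid.Sum +-commutativeMonoid

  index : Carrier → Fin size
  index x = proj₁ (enum-surj x)

  enum-index : ∀ x → enum (index x) ≈ x
  enum-index x = proj₂ (enum-surj x)

  instance
    size≢0 : NonZero size
    size≢0 = ℕ.>-nonZero (ℕₚ.≤-<-trans z≤n (toℕ<n (index 0#)))

  translation : Carrier → Permutation′ size
  translation g = permutation (λ i → index (enum i + g)) (λ i → index (enum i + - g))
    (λ i → enum-inj _ _ (trans (enum-index _) (trans (+-congʳ (enum-index _)) (cancel i (-‿inverseˡ g)))))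
    (λ i → enum-inj _ _ (trans (enum-index _) (trans (+-congʳ (enum-index _)) (cancel i (-‿inverseʳ g)))))
    where
    cancel : ∀ i {g h} → g + h ≈ 0# → (enum i + g) + h ≈ enum i
    cancel i g+h≈0 = trans (+-assoc _ _ _) (trans (+-congˡ g+h≈0) (+-identityʳ _))

  Respects≈ : (Carrier → ℕ) → Set (c ⊔ ℓ)
  Respects≈ F = ∀ {x y} → x ≈ y → F x ≡ F y

  total : (Carrier → ℕ) → ℕ
  total F = sum (λ i → F (enum i))

  total-translate : ∀ {F} → Respects≈ F → ∀ g → total (λ x → F (x + g)) ≡ total F
  total-translate {F} F-resp g = ≡.sym (≡.trans (∑-permute (F ∘ enum) (translation g))
    (sum-cong-≗ {size} (λ i → F-resp (enum-index (enum i + g)))))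

  -- After exchanging the sums, each translate has the same total. This serves both the count of
  -- representations and the averaging over lines.
  total-∑-translate : ∀ {F} → Respects≈ F → ∀ n g →
    total (λ x → ∑[ j < n ] F (x + toℕ j × g)) ≡ n * total F
  total-∑-translate {F} F-resp n g = ≡.trans (∑-comm {size} {n} (λ i j → F (enum i + toℕ j × g)))
    (≡.trans (sum-cong-≗ {n} (λ j → total-translate F-resp (toℕ j × g))) (sum-const n (total F)))

  -- Translation by x permutes R, so the sum of all elements is unchanged when size × x is added to
  -- it.
  size×≈0 : ∀ x → size × x ≈ 0#
  size×≈0 x = ∙-cancelˡ (ΣR.sum enum) (size × x) 0# (begin
    ΣR.sum enum + size × x                      ≈⟨ +-congˡ (ΣR.sum-replicate size) ⟨
    ΣR.sum enum + ΣR.sum {size} (λ _ → x)       ≈⟨ ΣR.∑-distrib-+ {size} enum (λ _ → x) ⟨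
    ΣR.sum (λ i → enum i + x)                   ≈⟨ ΣR.sum-cong-≋ {size} (λ i → enum-index (enum i + x)) ⟨
    ΣR.sum (λ i → enum (translation x ⟨$⟩ʳ i))  ≈⟨ ΣR.sum-permute enum (translation x) ⟨
    ΣR.sum enum                                 ≈⟨ +-identityʳ _ ⟨
    ΣR.sum enum + 0#                            ∎)

  -- Integers that kill R

  module Exponent (n : ℕ) (n×≈0 : ∀ x → n × x ≈ 0#) where

    -- The number of ways to write - x as a combination of gs with coefficients in {0, …, n-1}.
    representations : List Carrier → Carrier → ℕ
    representations []       x = indicator (x ≟R 0#)
    representations (g ∷ gs) x = ∑[ j < n ] representations gs (x + toℕ j × g)

    representations-resp : ∀ gs → Respects≈ (representations gs)
    representations-resp []       {x} {y} x≈y =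
      indicator-cong (x ≟R 0#) (y ≟R 0#) (trans (sym x≈y)) (trans x≈y)
    representations-resp (g ∷ gs) x≈y = sum-cong-≗ {n} (λ j → representations-resp gs (+-congʳ x≈y))

    -- Each generator replaces the function by a sum of n of its translates, which multiplies the
    -- total by n.
    total-representations : ∀ gs → total (representations gs) ≡ n ^ length gs * total (representations [])
    total-representations []       = ≡.sym (ℕₚ.*-identityˡ _)
    total-representations (g ∷ gs) = ≡.trans (total-∑-translate (representations-resp gs) n g)
      (≡.trans (cong (n *_) (total-representations gs)) (≡.sym (ℕₚ.*-assoc n _ _)))

    -- Adding the head generator shifts its coefficient cyclically; a later generator commutes with
    -- the offset j × g and is handled in the tail.
    representations-periodic : ∀ {gs h} → h ∈ gs → ∀ x → representations gs (x + h) ≡ representations gs x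
    representations-periodic {g ∷ gs} (here ≡.refl) x = ≡.trans
      (sum-cong-≗ {n} (λ j → representations-resp gs (+-assoc x g (toℕ j × g))))
      (sum-cycle (λ j → representations gs (x + j × g)) n (representations-resp gs (+-congˡ (n×≈0 g))))
    representations-periodic {g ∷ gs} {h} (there h∈gs) x = sum-cong-≗ {n} (λ j → ≡.trans
      (representations-resp gs (trans (+-assoc x h _) (trans (+-congˡ (+-comm h _)) (sym (+-assoc x _ h)))))
      (representations-periodic h∈gs (x + toℕ j × g)))

    total-indicator-0 : total (representations []) ≡ 1
    total-indicator-0 = ≡.trans
      (sum-cong-≗ {size} (λ i → indicator-cong (enum i ≟R 0#) (i Fin.≟ index 0#)
        (λ e → enum-inj _ _ (trans e (sym (enum-index 0#))))
        (λ { ≡.refl → enum-index 0# })))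
      (sum-δ (index 0#))
      where
      sum-δ : ∀ {N} (j : Fin N) → sum (λ i → indicator (i Fin.≟ j)) ≡ 1
      sum-δ {suc N} zero    = cong suc (≡.trans (sum-const N 0) (ℕₚ.*-zeroʳ N))
      sum-δ         (suc j) = sum-δ j

    -- With all of R as generators, the number of representations is the same for each element.
    size∣n^ : size ∣ n ^ length (tabulate enum)
    size∣n^ = divides (r 0#) (≡.trans (≡.sym (ℕₚ.*-identityʳ _))
      (≡.trans (cong (n ^ length (tabulate enum) *_) (≡.sym total-indicator-0))
      (≡.trans (≡.sym (total-representations (tabulate enum)))
      (≡.trans (sum-cong-≗ {size} r-constant)
      (≡.trans (sum-const size (r 0#)) (ℕₚ.*-comm size (r 0#)))))))
      where
      r = representations (tabulate enum)
      r-constant : ∀ i → r (enum i) ≡ r 0#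
      r-constant i = ≡.trans (representations-resp (tabulate enum) (sym (+-identityˡ (enum i))))
        (representations-periodic (∈-tabulate⁺ {f = enum} i) 0#)

  -- This takes the place of Cauchy's theorem: p divides |R|, hence a power of n, hence n.
  prime∣exponent : ∀ {p} n → Prime p → p ∣ size → (∀ x → n × x ≈ 0#) → p ∣ n
  prime∣exponent n pp p∣size n×≈0 =
    prime∣^⇒∣ n (length (tabulate enum)) pp (∣-trans p∣size (Exponent.size∣n^ n n×≈0))

  -- Powers on lines and congruences of powers

  ×1-^R : ∀ m n → (m × 1#) ^R n ≈ (m ^ n) × 1#
  ×1-^R m zero    = sym (×-homo-1 1#)
  ×1-^R m (suc n) = trans (*-congˡ (×1-^R m n)) (sym (×1-homo-* m (m ^ n)))

  IsPoly-linear-^ : ∀ x u n → IsPoly n (u ^R n) (λ t → (x + t × u) ^R n)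
  IsPoly-linear-^ x u zero    = constant (λ _ → refl)
  IsPoly-linear-^ x u (suc n) = IsPoly-linear-· x u (IsPoly-linear-^ x u n)

  -- The elements killed by m form a two-sided ideal: the integer m can be moved to either factor,
  -- and the factors are exchanged in turn.
  ×-cong-· : ∀ m {x x′ y y′} → m × x ≈ m × x′ → m × y ≈ m × y′ → m × (x · y) ≈ m × (x′ · y′)
  ×-cong-· m {x} {x′} {y} {y′} mx≈mx′ my≈my′ = begin
    m × (x · y)    ≈⟨ ×-assoc-* m x y ⟨
    (m × x) · y    ≈⟨ *-congʳ mx≈mx′ ⟩
    (m × x′) · y   ≈⟨ ×-assoc-* m x′ y ⟩
    m × (x′ · y)   ≈⟨ ×-comm-* m x′ y ⟨
    x′ · (m × y)   ≈⟨ *-congˡ my≈my′ ⟩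
    x′ · (m × y′)  ≈⟨ ×-comm-* m x′ y′ ⟩
    m × (x′ · y′)  ∎

  ×-cong-^R : ∀ m {x y} n → m × x ≈ m × y → m × (x ^R n) ≈ m × (y ^R n)
  ×-cong-^R m zero    mx≈my = refl
  ×-cong-^R m (suc n) mx≈my = ×-cong-· m mx≈my (×-cong-^R m n mx≈my)

  -- Here k is one less than in the theorem, so the potents satisfy xᵏ⁺² = x.
  module Potents (k : ℕ) where

    -- This is x^(k+2) - x, factored so that `IsPoly-linear-·` applies to it on a line.
    defect : Carrier → Carrier
    defect x = x · (x ^R suc k + - 1#)

    potent⇒defect≈0 : ∀ {x} → x ^R suc (suc k) ≈ x → defect x ≈ 0#
    potent⇒defect≈0 {x} x^≈x = begin
      x · (x ^R suc k + - 1#)           ≈⟨ distribˡ x _ _ ⟩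
      x ^R suc (suc k) + x · - 1#       ≈⟨ +-congʳ (trans x^≈x (sym (*-identityʳ x))) ⟩
      x · 1# + x · - 1#                 ≈⟨ distribˡ x _ _ ⟨
      x · (1# + - 1#)                   ≈⟨ *-congˡ (-‿inverseʳ 1#) ⟩
      x · 0#                            ≈⟨ zeroʳ x ⟩
      0#                                ∎

    ×-cong-defect : ∀ m {x y} → m × x ≈ m × y → m × defect x ≈ m × defect y
    ×-cong-defect m mx≈my = ×-cong-· m mx≈my
      (trans (×-distrib-+ _ _ m) (trans (+-congʳ (×-cong-^R m (suc k) mx≈my)) (sym (×-distrib-+ _ _ m))))

    -- For m the cofactor at p, the condition says that the p-primary component of x is
    -- (k+2)-potent.
    locallyPotent? : ∀ m x → Dec (m × defect x ≈ 0#)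
    locallyPotent? m x = (m × defect x) ≟R 0#

    locallyPotent-cong : ∀ m {x y} → m × x ≈ m × y →
      indicator (locallyPotent? m x) ≡ indicator (locallyPotent? m y)
    locallyPotent-cong m {x} {y} mx≈my = indicator-cong (locallyPotent? m x) (locallyPotent? m y)
      (trans (sym eq)) (trans eq)
      where eq = ×-cong-defect m mx≈my

    -- Counting on a line in the direction of the cofactor

    module _ {p} (p∣size : p ∣ size) (P : PrimePart size p) where
      open PrimePart P

      -- The element cofactor × y is killed by s and also by the p-part of |R|, and these are
      -- coprime because 0 < s < p.
      cofactor-cancel : ∀ s y → 0 < s → s < p → cofactor × (s × y) ≈ 0# → cofactor × y ≈ 0#
      cofactor-cancel s y 0<s s<p msy≈0 = ×-zero-coprime {s} {p ^ exponent}
        (coprime-^ exponent (Coprimality.sym (prime⇒coprime isPrime {{ℕ.>-nonZero 0<s}} s<p)))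
        (trans (×-swap s cofactor y) msy≈0)
        (trans (×-assocˡ y (p ^ exponent) cofactor) (trans (×-congˡ (≡.sym factors)) (size×≈0 y)))

      -- With u = cofactor × 1#, this is u^(k+2); the `0#` is the top coefficient of the padded
      -- constant - 1#.
      leading : Carrier
      leading = (cofactor × 1#) · ((cofactor × 1#) ^R suc k + 0#)

      -- Otherwise cofactor^(k+3), with one factor from outside and k + 2 from `leading`, would kill
      -- 1# and so R, and p would divide the cofactor.
      leading≉0 : ¬ (cofactor × leading ≈ 0#)
      leading≉0 m×leading≈0 = p∤cofactor (prime∣^⇒∣ cofactor (3 ℕ.+ k) isPrime
        (prime∣exponent (cofactor ^ (3 ℕ.+ k)) isPrime p∣size killed))
        where
        M = cofactor ^ (3 ℕ.+ k)
        M×1≈0 : M × 1# ≈ 0#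
        M×1≈0 = begin
          M × 1#                                      ≈⟨ ×-assocˡ 1# cofactor (cofactor ^ (2 ℕ.+ k)) ⟨
          cofactor × ((cofactor ^ (2 ℕ.+ k)) × 1#)    ≈⟨ ×-congʳ cofactor (×1-^R cofactor (2 ℕ.+ k)) ⟨
          cofactor × ((cofactor × 1#) ^R (2 ℕ.+ k))   ≈⟨ ×-congʳ cofactor (*-congˡ (+-identityʳ _)) ⟨
          cofactor × leading                          ≈⟨ m×leading≈0 ⟩
          0#                                          ∎
        killed : ∀ x → M × x ≈ 0#
        killed x = begin
          M × x          ≈⟨ ×-congʳ M (*-identityˡ x) ⟨
          M × (1# · x)   ≈⟨ ×-assoc-* M 1# x ⟨
          (M × 1#) · x   ≈⟨ *-congʳ M×1≈0 ⟩
          0# · x         ≈⟨ zeroˡ x ⟩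
          0#             ∎

      locallyPotent-on-line : ∀ x →
        ∑[ t < p ] indicator (locallyPotent? cofactor (x + toℕ t × (cofactor × 1#))) ≤ suc (suc k)
      locallyPotent-on-line x = roots≤degree cofactor p (λ y → (cofactor × y) ≟R 0#) cofactor-cancel p ℕₚ.≤-refl
        -- The constant - 1# is given formal degree k + 1 to match the power; the linear factor
        -- raises the degree to k + 2.
        (IsPoly-linear-· x u (IsPoly-+ (IsPoly-linear-^ x u (suc k)) (IsPoly-const k (- 1#)))) leading≉0
        where u = cofactor × 1#

    -- Averaging over the primes one at a time

    weight : ∀ {ps} → All (PrimePart size) ps → Carrier → ℕ
    weight []       x = 1
    weight (P ∷ Ps) x = indicator (locallyPotent? (PrimePart.cofactor P) x) * weight Ps x

    weight-resp : ∀ {ps} (Ps : All (PrimePart size) ps) → Respects≈ (weight Ps)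
    weight-resp []       x≈y = ≡.refl
    weight-resp (P ∷ Ps) x≈y = cong₂ _*_
      (locallyPotent-cong (PrimePart.cofactor P) (×-congʳ (PrimePart.cofactor P) x≈y)) (weight-resp Ps x≈y)

    weight-potent : ∀ {ps} (Ps : All (PrimePart size) ps) {x} → x ^R suc (suc k) ≈ x → weight Ps x ≡ 1
    weight-potent []       x^≈x = ≡.refl
    weight-potent (P ∷ Ps) {x} x^≈x = cong₂ _*_
      (indicator-true (locallyPotent? m x) (trans (×-congʳ m (potent⇒defect≈0 x^≈x)) (×-zeroʳ m)))
      (weight-potent Ps x^≈x)
      where m = PrimePart.cofactor P

    -- A step along the line for p changes x by a multiple of mp × 1#, which mq kills because |R|
    -- divides mq * mp.
    weight-invariant : ∀ {p ps} (P : PrimePart size p) (Ps : All (PrimePart size) ps) → All (p ≢_) ps →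
      ∀ t x → weight Ps (x + t × (PrimePart.cofactor P × 1#)) ≡ weight Ps x
    weight-invariant P []       []         t x = ≡.refl
    weight-invariant P (Q ∷ Qs) (p≢q ∷ p∉) t x =
      cong₂ _*_ (locallyPotent-cong mq vanish) (weight-invariant P Qs p∉ t x)
      where
      mp = PrimePart.cofactor P
      mq = PrimePart.cofactor Q
      vanish : mq × (x + t × (mp × 1#)) ≈ mq × x
      vanish = begin
        mq × (x + t × (mp × 1#))            ≈⟨ ×-distrib-+ x _ mq ⟩
        mq × x + mq × (t × (mp × 1#))       ≈⟨ +-congˡ (×-swap mq t _) ⟩
        mq × x + t × (mq × (mp × 1#))       ≈⟨ +-congˡ (×-congʳ t (×-assocˡ 1# mq mp)) ⟩
        mq × x + t × ((mq * mp) × 1#)       ≈⟨ +-congˡ (×-congʳ t (×-zero-∣ (N∣cofactors P Q p≢q) (size×≈0 1#))) ⟩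
        mq × x + t × 0#                     ≈⟨ +-congˡ (×-zeroʳ t) ⟩
        mq × x + 0#                         ≈⟨ +-identityʳ _ ⟩
        mq × x                              ∎

    -- Induction on the list: removing the prime p trades a factor p on the left for a factor k + 2
    -- on the right.
    total-weight : ∀ {ps} (Ps : All (PrimePart size) ps) → All (_∣ size) ps → Unique ps →
      product ps * total (weight Ps) ≤ suc (suc k) ^ length ps * size
    total-weight [] [] [] = ℕₚ.≤-reflexive (cong (1 *_) (≡.trans (sum-const size 1) (ℕₚ.*-identityʳ size)))
    total-weight {p ∷ ps} (P ∷ Ps) (p∣size ∷ ps∣size) (p∉ ∷ unique) = begin′
      p * product ps * total (weight (P ∷ Ps))                       ≡⟨ cong (_* total (weight (P ∷ Ps))) (ℕₚ.*-comm p (product ps)) ⟩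
      product ps * p * total (weight (P ∷ Ps))                       ≡⟨ ℕₚ.*-assoc (product ps) p _ ⟩
      -- Sum over the p points of the line from each x: every translate has the same total, which
      -- yields the factor p.
      product ps * (p * total (weight (P ∷ Ps)))                     ≡⟨ cong (product ps *_) (total-∑-translate (weight-resp (P ∷ Ps)) p u) ⟨
      product ps * total (λ x → ∑[ t < p ] weight (P ∷ Ps) (x + toℕ t × u))
        ≤⟨ ℕₚ.*-monoʳ-≤ (product ps) (sum-mono {size} (λ i → line (enum i))) ⟩
      product ps * total (λ x → suc (suc k) * weight Ps x)           ≡⟨ cong (product ps *_) (*-distribˡ-sum {size} (suc (suc k)) (weight Ps ∘ enum)) ⟨
      product ps * (suc (suc k) * total (weight Ps))                 ≡⟨ ℕₚ.*-assoc (product ps) (suc (suc k)) _ ⟨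
      product ps * suc (suc k) * total (weight Ps)                   ≡⟨ cong (_* total (weight Ps)) (ℕₚ.*-comm (product ps) (suc (suc k))) ⟩
      suc (suc k) * product ps * total (weight Ps)                   ≡⟨ ℕₚ.*-assoc (suc (suc k)) (product ps) _ ⟩
      suc (suc k) * (product ps * total (weight Ps))                 ≤⟨ ℕₚ.*-monoʳ-≤ (suc (suc k)) (total-weight Ps ps∣size unique) ⟩
      suc (suc k) * (suc (suc k) ^ length ps * size)                 ≡⟨ ℕₚ.*-assoc (suc (suc k)) (suc (suc k) ^ length ps) size ⟨
      suc (suc k) ^ length (p ∷ ps) * size                           ∎′
      where
      open ≤-Reasoning renaming (begin_ to begin′_; _∎ to _∎′)
      u = PrimePart.cofactor P × 1#
      ι : Carrier → ℕ
      ι x = indicator (locallyPotent? (PrimePart.cofactor P) x)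
      line : ∀ x → ∑[ t < p ] weight (P ∷ Ps) (x + toℕ t × u) ≤ suc (suc k) * weight Ps x
      line x = begin′
        ∑[ t < p ] (ι (x + toℕ t × u) * weight Ps (x + toℕ t × u))
          -- The weight at the remaining primes is constant on the line, so it factors out and only
          -- the roots at p are counted.
          ≡⟨ sum-cong-≗ {p} (λ t → cong (ι (x + toℕ t × u) *_) (weight-invariant P Ps p∉ (toℕ t) x)) ⟩
        ∑[ t < p ] (ι (x + toℕ t × u) * weight Ps x)    ≡⟨ *-distribʳ-sum {p} (weight Ps x) (λ t → ι (x + toℕ t × u)) ⟨
        (∑[ t < p ] ι (x + toℕ t × u)) * weight Ps x    ≤⟨ ℕₚ.*-monoˡ-≤ (weight Ps x) (locallyPotent-on-line p∣size P x) ⟩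
        suc (suc k) * weight Ps x                       ∎′

    potentCount≤total-weight : ∀ {ps} (Ps : All (PrimePart size) ps) → potentCount (suc (suc k)) ≤ total (weight Ps)
    potentCount≤total-weight Ps = ℕₚ.≤-trans
      (ℕₚ.≤-reflexive (length-filter-tabulate (λ i → (enum i ^R suc (suc k)) ≟R enum i) id))
      (sum-mono {size} potent≤weight)
      where
      potent≤weight : ∀ i → indicator ((enum i ^R suc (suc k)) ≟R enum i) ≤ weight Ps (enum i)
      potent≤weight i with (enum i ^R suc (suc k)) ≟R enum i
      ... | yes x^≈x = ℕₚ.≤-reflexive (≡.sym (weight-potent Ps x^≈x))
      ... | no  _    = z≤n

    potentCount-bound : potentCount (suc (suc k)) * product (primeDivisors size) ≤
      suc (suc k) ^ length (primeDivisors size) * size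
    potentCount-bound = ℕₚ.≤-trans (ℕₚ.≤-reflexive (ℕₚ.*-comm (potentCount (suc (suc k))) _))
      (ℕₚ.≤-trans (ℕₚ.*-monoʳ-≤ (product (primeDivisors size)) (potentCount≤total-weight parts))
        (total-weight parts (All.map proj₂ prime-divisors) (filter⁺ prime-divisor? (upTo⁺ (suc size)))))
      where
      prime-divisor? = λ p → prime? p ×-dec p ∣? size
      prime-divisors = all-filter prime-divisor? (upTo (suc size))
      parts : All (PrimePart size) (primeDivisors size)
      parts = All.map (λ (pp , _) → primePart pp size) prime-divisors

-- Passage to the stated exponent

^-distribʳ-* : ∀ m n e → (m * n) ^ e ≡ m ^ e * n ^ e
^-distribʳ-* m n zero    = ≡.refl
^-distribʳ-* m n (suc e) = ≡.trans (cong (m * n *_) (^-distribʳ-* m n e)) (ℕₚ.[m*n]*[o*p]≡[m*o]*[n*p] m n (m ^ e) (n ^ e))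

-- The inequality is multiplied by the product of the primes and raised to the power k + 1, so that
-- |R|^(2k/(k+1)) becomes |R|^(2k).
theorem3 : ∀ {c ℓ : Level} (R : FiniteRing c ℓ) (k : ℕ) → 1 ≤ k →
    (FiniteRing.potentCount R (suc k) * product (primeDivisors (FiniteRing.size R))) ^ suc k
    ≤ suc k ^ (length (primeDivisors (FiniteRing.size R)) * suc k) * FiniteRing.size R ^ (2 * k)
theorem3 R (suc k) _ = begin
  (potentCount (2 ℕ.+ k) * product (primeDivisors size)) ^ (2 ℕ.+ k)  ≤⟨ ℕₚ.^-monoˡ-≤ (2 ℕ.+ k) potentCount-bound ⟩
  ((2 ℕ.+ k) ^ n * size) ^ (2 ℕ.+ k)                  ≡⟨ ^-distribʳ-* ((2 ℕ.+ k) ^ n) size (2 ℕ.+ k) ⟩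
  ((2 ℕ.+ k) ^ n) ^ (2 ℕ.+ k) * size ^ (2 ℕ.+ k)      ≡⟨ cong (_* size ^ (2 ℕ.+ k)) (ℕₚ.^-*-assoc (2 ℕ.+ k) n (2 ℕ.+ k)) ⟩
  -- The theorem's k is `suc k` here; |R| ≥ 1 and k + 2 ≤ 2(k + 1) allow the exponent of |R| to be
  -- raised.
  (2 ℕ.+ k) ^ (n * (2 ℕ.+ k)) * size ^ (2 ℕ.+ k)      ≤⟨ ℕₚ.*-monoʳ-≤ ((2 ℕ.+ k) ^ (n * (2 ℕ.+ k))) (ℕₚ.^-monoʳ-≤ size k+2≤2[k+1]) ⟩
  (2 ℕ.+ k) ^ (n * (2 ℕ.+ k)) * size ^ (2 * suc k)    ∎
  where
  open FiniteRing R using (size; potentCount)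
  open FiniteRingCounting R using (size≢0; module Potents)
  open Potents k using (potentCount-bound)
  open ≤-Reasoning
  n = length (primeDivisors size)
  k+2≤2[k+1] : 2 ℕ.+ k ≤ 2 * suc k
  k+2≤2[k+1] = s≤s (ℕₚ.≤-trans (ℕₚ.m≤n+m (suc k) k) (ℕₚ.+-monoʳ-≤ k (ℕₚ.m≤m+n (suc k) 0)))
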